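{- Let $f=\bigvee_{i=1}^mT_i$ be a DNF formula of width $w$ with $m$ terms, each of which is non-constant. Then there exists $S\subseteq\{1,\dots,m\}$ with $|S|\ge m/2^w$ such that the formula $g=\bigvee_{j\in S}T_j$ is unate.
   Context: A term is an AND of literals; a DNF formula is an OR of terms; it has width $w$ if every term has at most $w$ literals. A term is non-constant if it contains at least one literal and does not contain both a variable and its negation. A DNF formula is unate if it does not contain both a variable and its negation (anywhere in the formula). -}

module Defs where

open import Data.Bool.Base using (true; false)
open import Data.Fin.Base using (Fin)
open import Data.Fin.Subset using (Subset; _∈_; ∣_∣)
open import Data.Nat.Base using (ℕ; _+_; _≤_)
open import Data.Product.Base using (∃-syntax; _×_)
open import Data.Vec.Base using (Vec; []; _∷_)
open import Data.Vec.Relation.Unary.All using (All)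
open import Data.Vec.Relation.Unary.Any using (Any)
open import Relation.Nullary.Negation.Core using (¬_)

data Literal (n : ℕ) : Set where
  var neg : Fin n → Literal n

-- An AND of literals over n variables, given by its finite set of literals:
-- the variables occurring unnegated and those occurring negated.  The two
-- subsets may overlap (the term then contains x and ¬x and is constantly
-- false) and may both be empty (the term is then constantly true).
record Term (n : ℕ) : Set where
  constructor term
  field
    unnegated : Subset n
    negated   : Subset n

open Term public

infix 4 _∈ᵗ_ _∈ᶠ_

_∈ᵗ_ : ∀ {n} → Literal n → Term n → Set
var x ∈ᵗ T = x ∈ unnegated T
neg x ∈ᵗ T = x ∈ negated T

-- Number of distinct literals; x and ¬x count separately.
size : ∀ {n} → Term n → ℕ
size T = ∣ unnegated T ∣ + ∣ negated T ∣

NonConstant : ∀ {n} → Term n → Set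
NonConstant {n} T =
  (∃[ ℓ ] ℓ ∈ᵗ T) × ¬ (∃[ x ] (var x ∈ᵗ T × neg x ∈ᵗ T))

-- The OR of an indexed family of m terms; a term may occur at several indices.
DNF : ℕ → ℕ → Set
DNF n m = Vec (Term n) m

-- An upper bound: w need not be attained.
HasWidth : ∀ {n m} → ℕ → DNF n m → Set
HasWidth w f = All (λ T → size T ≤ w) f

_∈ᶠ_ : ∀ {n m} → Literal n → DNF n m → Set
ℓ ∈ᶠ f = Any (ℓ ∈ᵗ_) f

-- The two occurrences may be in different terms.
Unate : ∀ {n m} → DNF n m → Set
Unate f = ¬ (∃[ x ] (var x ∈ᶠ f × neg x ∈ᶠ f))

-- ⋁_{j ∈ S} T_j, the terms kept in increasing order of j.
subformula : ∀ {n m} → DNF n m → (S : Subset m) → DNF n ∣ S ∣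
subformula []      []          = []
subformula (T ∷ f) (true  ∷ S) = T ∷ subformula f S
subformula (T ∷ f) (false ∷ S) = subformula f S

{-# OPTIONS --safe #-}

-- For a uniformly random assignment σ, a term without complementary literals
-- is satisfied by σ with probability 2^(-size) ≥ 2^(-w), so some σ satisfies at
-- least m / 2^w of the terms.  These form a unate formula, since a variable
-- occurs in them only with the sign given by σ.  Assignments are
-- encoded as the subset of variables they make true.
module Submission where

open import Defs
open import Algebra.Properties.CommutativeSemigroup using (interchange)
open import Data.Bool.Base using (Bool; true; false; if_then_else_; not; _∧_)
open import Data.Fin.Subset using (Subset; ∣_∣; _∈_; _∉_)
open import Data.Integer.Base using (+_)
import Data.Integer.Base as ℤ
import Data.Integer.Properties as ℤₚ
open import Data.Nat.Base using (ℕ; zero; suc; _+_; _*_; _^_; _≤_; z≤n; NonZero)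
open import Data.Nat.Properties
open import Data.Nat.Solver using (module +-*-Solver)
open import Data.Product.Base using (Σ-syntax; ∃-syntax; _×_; _,_; proj₂)
open import Data.Rational.Base using (_/_; _≥_)
import Data.Rational.Properties as ℚₚ
import Data.Rational.Unnormalised.Base as ℚᵘ
import Data.Rational.Unnormalised.Properties as ℚᵘₚ
open import Data.Sum.Base using (inj₁; inj₂)
open import Data.Vec.Base using ([]; _∷_; map; here; there)
open import Data.Vec.Relation.Unary.All as All using (All; []; _∷_)
open import Data.Vec.Relation.Unary.Any using (Any; here; there)
open import Relation.Binary.PropositionalEquality
  using (_≡_; refl; sym; trans; cong; cong₂; subst; subst₂; module ≡-Reasoning)
open import Relation.Nullary.Negation.Core using (¬_; contradiction)

∑ : ∀ {n} → (Subset n → ℕ) → ℕ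
∑ {zero}  F = F []
∑ {suc n} F = ∑ (λ σ → F (true ∷ σ)) + ∑ (λ σ → F (false ∷ σ))

∑-zero : ∀ n → ∑ {n} (λ _ → 0) ≡ 0
∑-zero zero    = refl
∑-zero (suc n) = cong₂ _+_ (∑-zero n) (∑-zero n)

∑-cong : ∀ {n} {F G : Subset n → ℕ} → (∀ σ → F σ ≡ G σ) → ∑ F ≡ ∑ G
∑-cong {zero}  F≗G = F≗G []
∑-cong {suc n} F≗G = cong₂ _+_ (∑-cong (λ σ → F≗G (true ∷ σ))) (∑-cong (λ σ → F≗G (false ∷ σ)))

∑-distrib-+ : ∀ {n} (F G : Subset n → ℕ) → ∑ (λ σ → F σ + G σ) ≡ ∑ F + ∑ G
∑-distrib-+ {zero}  F G = refl
∑-distrib-+ {suc n} F G = trans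
  (cong₂ _+_ (∑-distrib-+ (λ σ → F (true ∷ σ)) (λ σ → G (true ∷ σ)))
             (∑-distrib-+ (λ σ → F (false ∷ σ)) (λ σ → G (false ∷ σ))))
  (interchange +-commutativeSemigroup (∑ (λ σ → F (true ∷ σ))) _ _ _)

+-mono-≤-double : ∀ k {a b c} → a ≤ k * c → b ≤ k * c → a + b ≤ (2 * k) * c
+-mono-≤-double k {c = c} a≤kc b≤kc = ≤-trans (+-mono-≤ a≤kc b≤kc)
  (≤-reflexive (solve 2 (λ k c → k :* c :+ k :* c := (con 2 :* k) :* c) refl k c))
  where open +-*-Solver

∑≤2^n*max : ∀ {n} (F : Subset n → ℕ) → ∃[ σ ] ∑ F ≤ 2 ^ n * F σ
∑≤2^n*max {zero}  F = [] , ≤-reflexive (sym (*-identityˡ (F [])))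
∑≤2^n*max {suc n} F with ∑≤2^n*max (λ σ → F (true ∷ σ)) | ∑≤2^n*max (λ σ → F (false ∷ σ))
... | σ , ∑≤σ | τ , ∑≤τ with ≤-total (F (true ∷ σ)) (F (false ∷ τ))
...   | inj₁ σ≤τ = false ∷ τ , +-mono-≤-double (2 ^ n) (≤-trans ∑≤σ (*-monoʳ-≤ (2 ^ n) σ≤τ)) ∑≤τ
...   | inj₂ τ≤σ = true ∷ σ , +-mono-≤-double (2 ^ n) ∑≤σ (≤-trans ∑≤τ (*-monoʳ-≤ (2 ^ n) τ≤σ))

𝟙 : Bool → ℕ
𝟙 b = if b then 1 else 0

satisfies : ∀ {n} → Subset n → Term n → Bool
satisfies []      (term []      [])      = true
satisfies (s ∷ σ) (term (p ∷ P) (q ∷ Q)) =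
  not (if s then q else p) ∧ satisfies σ (term P Q)

satisfies⇒∈ : ∀ {n} {σ : Subset n} {x} (T : Term n) →
  satisfies σ T ≡ true → x ∈ unnegated T → x ∈ σ
satisfies⇒∈ {σ = true  ∷ σ} (term (true ∷ P) (q     ∷ Q)) sat here = here
satisfies⇒∈ {σ = true  ∷ σ} (term (p    ∷ P) (false ∷ Q)) sat (there x∈P) =
  there (satisfies⇒∈ (term P Q) sat x∈P)
satisfies⇒∈ {σ = false ∷ σ} (term (false ∷ P) (q ∷ Q)) sat (there x∈P) =
  there (satisfies⇒∈ (term P Q) sat x∈P)

satisfies⇒∉ : ∀ {n} {σ : Subset n} {x} (T : Term n) →
  satisfies σ T ≡ true → x ∈ negated T → x ∉ σ
satisfies⇒∉ (term (p ∷ P) (true  ∷ Q)) () here here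
satisfies⇒∉ {σ = true  ∷ σ} (term (p     ∷ P) (false ∷ Q)) sat (there x∈Q) (there x∈σ) =
  satisfies⇒∉ (term P Q) sat x∈Q x∈σ
satisfies⇒∉ {σ = false ∷ σ} (term (false ∷ P) (q     ∷ Q)) sat (there x∈Q) (there x∈σ) =
  satisfies⇒∉ (term P Q) sat x∈Q x∈σ

Consistent : ∀ {n} → Term n → Set
Consistent T = ¬ (∃[ x ] (var x ∈ᵗ T × neg x ∈ᵗ T))

2^size*∑satisfies : ∀ {n} (T : Term n) → Consistent T →
  2 ^ size T * ∑ (λ σ → 𝟙 (satisfies σ T)) ≡ 2 ^ n
2^size*∑satisfies (term [] []) _ = refl
2^size*∑satisfies {suc n} (term (p ∷ P) (q ∷ Q)) cons = step p q cons
  where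
  open ≡-Reasoning
  open +-*-Solver

  k = 2 ^ size (term P Q)
  X = ∑ (λ σ → 𝟙 (satisfies σ (term P Q)))

  rest : ∀ {p q} → Consistent (term (p ∷ P) (q ∷ Q)) → k * X ≡ 2 ^ n
  rest c = 2^size*∑satisfies (term P Q) λ (x , x∈P , x∈Q) → c (_ , there x∈P , there x∈Q)

  step : ∀ p q → Consistent (term (p ∷ P) (q ∷ Q)) →
    2 ^ size (term (p ∷ P) (q ∷ Q)) *
      ∑ (λ σ → 𝟙 (satisfies σ (term (p ∷ P) (q ∷ Q)))) ≡ 2 ^ suc n
  step true true c = contradiction (_ , here , here) c
  step false false c = begin
    k * (X + X)  ≡⟨ solve 2 (λ k x → k :* (x :+ x) := con 2 :* (k :* x)) refl k X ⟩
    2 * (k * X)  ≡⟨ cong (2 *_) (rest c) ⟩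
    2 ^ suc n    ∎
  step true false c = begin
    2 * k * (X + ∑ {n} (λ _ → 0))  ≡⟨ cong (λ z → 2 * k * (X + z)) (∑-zero n) ⟩
    2 * k * (X + 0)                ≡⟨ cong (2 * k *_) (+-identityʳ X) ⟩
    2 * k * X                      ≡⟨ *-assoc 2 k X ⟩
    2 * (k * X)                    ≡⟨ cong (2 *_) (rest c) ⟩
    2 ^ suc n                      ∎
  step false true c = begin
    2 ^ ((∣ P ∣) + suc (∣ Q ∣)) * (∑ {n} (λ _ → 0) + X)
      ≡⟨ cong₂ (λ e z → 2 ^ e * (z + X)) (+-suc ∣ P ∣ ∣ Q ∣) (∑-zero n) ⟩
    2 * k * X    ≡⟨ *-assoc 2 k X ⟩
    2 * (k * X)  ≡⟨ cong (2 *_) (rest c) ⟩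
    2 ^ suc n    ∎

∣b∷S∣ : ∀ {m} b (S : Subset m) → ∣ b ∷ S ∣ ≡ 𝟙 b + ∣ S ∣
∣b∷S∣ true  S = refl
∣b∷S∣ false S = refl

m*2^n≤2^w*∑ : ∀ {n m w} (f : DNF n m) → HasWidth w f → All Consistent f →
  m * 2 ^ n ≤ 2 ^ w * ∑ (λ σ → ∣ map (satisfies σ) f ∣)
m*2^n≤2^w*∑ [] _ _ = z≤n
m*2^n≤2^w*∑ {n} {suc m} {w} (T ∷ f) (size≤w ∷ width) (cons ∷ conss) = begin
  2 ^ n + m * 2 ^ n
    ≡⟨ cong (_+ m * 2 ^ n) (2^size*∑satisfies T cons) ⟨
  2 ^ size T * ∑ F + m * 2 ^ n
    ≤⟨ +-mono-≤ (*-monoˡ-≤ (∑ F) (^-monoʳ-≤ 2 size≤w)) (m*2^n≤2^w*∑ f width conss) ⟩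
  2 ^ w * ∑ F + 2 ^ w * ∑ G
    ≡⟨ *-distribˡ-+ (2 ^ w) (∑ F) (∑ G) ⟨
  2 ^ w * (∑ F + ∑ G)
    ≡⟨ cong (2 ^ w *_) (∑-distrib-+ F G) ⟨
  2 ^ w * ∑ (λ σ → F σ + G σ)
    ≡⟨ cong (2 ^ w *_) (∑-cong (λ σ → ∣b∷S∣ (satisfies σ T) (map (satisfies σ) f))) ⟨
  2 ^ w * ∑ (λ σ → ∣ map (satisfies σ) (T ∷ f) ∣) ∎
  where
  open ≤-Reasoning
  F = λ σ → 𝟙 (satisfies σ T)
  G = λ σ → ∣ map (satisfies σ) f ∣

any-subformula : ∀ {n m} {A : Term n → Set} (b : Term n → Bool) (f : DNF n m) →
  Any A (subformula f (map b f)) → ∃[ T ] (b T ≡ true × A T)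
any-subformula b (T ∷ f) a with b T in bT
any-subformula b (T ∷ f) (here aT) | true  = T , bT , aT
any-subformula b (T ∷ f) (there a) | true  = any-subformula b f a
any-subformula b (T ∷ f) a         | false = any-subformula b f a

unate-satisfied : ∀ {n m} (σ : Subset n) (f : DNF n m) →
  Unate (subformula f (map (satisfies σ) f))
unate-satisfied σ f (x , x∈f , ¬x∈f)
  with any-subformula (satisfies σ) f x∈f | any-subformula (satisfies σ) f ¬x∈f
... | T , satT , x∈T | U , satU , ¬x∈U =
  satisfies⇒∉ {σ = σ} U satU ¬x∈U (satisfies⇒∈ T satT x∈T)

a≤d*b⇒a/d≤b : ∀ a b d .{{_ : NonZero d}} → a ≤ d * b → + b / 1 ≥ + a / d
a≤d*b⇒a/d≤b a b d@(suc d-1) a≤db = ℚₚ.toℚᵘ-cancel-≤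
  (ℚᵘₚ.≤-respˡ-≃ (ℚᵘₚ.≃-sym (ℚₚ.toℚᵘ-fromℚᵘ (ℚᵘ.mkℚᵘ (+ a) d-1)))
  (ℚᵘₚ.≤-respʳ-≃ (ℚᵘₚ.≃-sym (ℚₚ.toℚᵘ-fromℚᵘ (ℚᵘ.mkℚᵘ (+ b) 0)))
  (ℚᵘ.*≤* (subst₂ ℤ._≤_ (sym (ℤₚ.*-identityʳ (+ a))) (ℤₚ.pos-* b d)
    (ℤ.+≤+ (subst (a ≤_) (*-comm d b) a≤db))))))

lemma2p7 : (n m w : ℕ) (f : DNF n m) → HasWidth w f → All NonConstant f →
    Σ[ S ∈ Subset m ] ((+ ∣ S ∣ / 1 ≥ _/_ (+ m) (2 ^ w) {{m^n≢0 2 w}}) × Unate (subformula f S))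
lemma2p7 n m w f width nonConstant with ∑≤2^n*max (λ σ → ∣ map (satisfies σ) f ∣)
... | σ , ∑≤ = map (satisfies σ) f , a≤d*b⇒a/d≤b m _ (2 ^ w) {{m^n≢0 2 w}} m≤ , unate-satisfied σ f
  where
  s = ∣ map (satisfies σ) f ∣

  m≤ : m ≤ 2 ^ w * s
  m≤ = *-cancelʳ-≤ m (2 ^ w * s) (2 ^ n) {{m^n≢0 2 n}} (begin
    m * 2 ^ n
      ≤⟨ m*2^n≤2^w*∑ f width (All.map proj₂ nonConstant) ⟩
    2 ^ w * ∑ (λ τ → ∣ map (satisfies τ) f ∣)
      ≤⟨ *-monoʳ-≤ (2 ^ w) ∑≤ ⟩
    2 ^ w * (2 ^ n * s)
      ≡⟨ cong (2 ^ w *_) (*-comm (2 ^ n) s) ⟩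
    2 ^ w * (s * 2 ^ n)
      ≡⟨ *-assoc (2 ^ w) s (2 ^ n) ⟨
    2 ^ w * s * 2 ^ n ∎)
    where open ≤-Reasoning
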